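{- Let $\kappa$ be a regular uncountable cardinal and $\lambda>\kappa$ a cardinal. Let $H$ be an ideal on $P_\kappa(\lambda)$ such that $\mathrm{cof}(H)<\mathfrak d^\kappa_{\kappa,\lambda}$. Then $\mathfrak a_H>\kappa$ and $H$ is a weak $\pi$-point.
   Context: For a cardinal $\mu$ and a set $A$, $P_\mu(A)=\{a\subseteq A:|a|<\mu\}$. An ideal on an infinite set $S$ is a collection $K$ of subsets of $S$ containing all singletons, closed under subsets and finite unions, with $S\notin K$; $K^+=P(S)\setminus K$; $\mathrm{cof}(K)$ is the least cardinality of an $X\subseteq K$ with $K=\bigcup_{A\in X}P(A)$. $I_{\kappa,\lambda}$ is the set of all $A\subseteq P_\kappa(\lambda)$ such that $A\cap\{b\in P_\kappa(\lambda):a\subseteq b\}=\emptyset$ for some $a\in P_\kappa(\lambda)$. "Ideal on $P_\kappa(\lambda)$" always means an ideal $H$ on $P_\kappa(\lambda)$ that is $\kappa$-complete (closed under unions of fewer than $\kappa$ members) and fine ($I_{\kappa,\lambda}\subseteq H$). $\mathfrak d^\kappa_{\kappa,\lambda}$ is the least cardinality of an $F\subseteq{}^\kappa(P_\kappa(\lambda))$ such that for every $g\in{}^\kappa(P_\kappa(\lambda))$ there is $f\in F$ with $g(\alpha)\subseteq f(\alpha)$ for all $\alpha\in\kappa$. For an ideal $H$ on $P_\kappa(\lambda)$, $\mathcal M_H^{\ge\kappa}$ is the set of all $Q\subseteq H^+$ such that (i) $|Q|\ge\kappa$, (ii) $A\cap B\in H$ for all distinct $A,B\in Q$, and (iii)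 for every $C\in H^+$ there is $A\in Q$ with $A\cap C\in H^+$. $\mathfrak a_H$ is the least cardinality of a member of $\mathcal M_H^{\ge\kappa}$ if $\mathcal M_H^{\ge\kappa}\neq\emptyset$, and $2^{(\lambda^{<\kappa})^+}$ otherwise. $H$ is a weak $\pi$-point if for every $f\in{}^\kappa H$ and $A\in H^+$ there is $B\in H^+\cap P(A)$ such that $B\cap f(\alpha)\in I_{\kappa,\lambda}$ for every $\alpha\in\kappa$. -}

module Defs where

open import Data.Bool using (Bool; T; _∧_; _∨_)
open import Data.Nat using (ℕ)
open import Data.Product using (Σ; ∃; _×_)
open import Data.Refinement using (Refinement; value)
open import Data.Sum using (_⊎_)
open import Function.Bundles using (_↣_; _⤖_; _⇔_)
open import Induction.WellFounded using (WellFounded)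
open import Level using (Level; _⊔_; suc)
open import Relation.Binary using (Rel; IsStrictTotalOrder)
open import Relation.Binary.PropositionalEquality using (_≡_; _≢_)
open import Relation.Nullary using (¬_)
open import Relation.Unary using (Pred)

private
  variable
    a b ℓ p : Level

-- Conventions.  The ambient theory is ZFC, so everything below is meant to be
-- used under excluded middle and function extensionality (as `Dec` is not
-- truncated, excluded middle also yields choice).
--
-- A set that occurs as an element of another set is a characteristic function
-- into Bool: under these axioms every predicate has exactly one, and _≡_ is
-- then extensional equality of sets.  A collection which is only ever
-- quantified over or measured is a `Pred`.  `Refinement` has proof-irrelevant
-- witnesses, so Refinement A X has exactly one element for each member of X,
-- even if X x is not a proposition.

Subset : Set a → Set a
Subset A = A → Bool

module _ {A : Set a} where

  infix 4 _∈_ _⊆_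
  infixr 7 _∩_
  infixr 6 _∪_

  _∈_ : A → Subset A → Set
  x ∈ X = T (X x)

  _⊆_ : Subset A → Subset A → Set a
  X ⊆ Y = ∀ x → x ∈ X → x ∈ Y

  _∩_ _∪_ : Subset A → Subset A → Subset A
  (X ∩ Y) x = X x ∧ Y x
  (X ∪ Y) x = X x ∨ Y x

  IsSingleton : A → Subset A → Set a
  IsSingleton x X = ∀ y → y ∈ X ⇔ y ≡ x

  IsUnionOf : Pred (Subset A) p → Subset A → Set (a ⊔ p)
  IsUnionOf Y U = ∀ x → x ∈ U ⇔ (∃ λ X → Y X × x ∈ X)

infix 4 _≺_

_≺_ : Set a → Set b → Set (a ⊔ b)
A ≺ B = (A ↣ B) × ¬ (B ↣ A)

-- Cardinals are initial ordinals: well-ordered types that do not inject into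
-- any of their proper initial segments.
record Cardinal (ℓ : Level) : Set (suc ℓ) where
  field
    Carrier            : Set ℓ
    _<_                : Rel Carrier ℓ
    isStrictTotalOrder : IsStrictTotalOrder _≡_ _<_
    wellFounded        : WellFounded _<_

  Below : Carrier → Set ℓ
  Below α = Refinement Carrier (_< α)

  field
    initial : ∀ α → ¬ (Carrier ↣ Below α)

∣_∣ : Cardinal ℓ → Set ℓ
∣ μ ∣ = Cardinal.Carrier μ

infix 4 _<ᶜ_

_<ᶜ_ : Cardinal a → Cardinal b → Set (a ⊔ b)
μ <ᶜ ν = ∣ μ ∣ ≺ ∣ ν ∣

-- μ = min { |X| : Φ X }.
IsLeastCardinality : {A : Set a} → Pred (Pred A ℓ) p → Cardinal b →
                     Set (a ⊔ b ⊔ suc ℓ ⊔ p)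
IsLeastCardinality {A = A} Φ μ =
  (∃ λ X → Φ X × (Refinement A X ⤖ ∣ μ ∣)) ×
  (∀ X → Φ X → ∣ μ ∣ ↣ Refinement A X)

-- Regularity is "κ is infinite and cf(κ) = κ".
module _ (κ : Cardinal ℓ) where
  open Cardinal κ

  Unbounded : Pred (Pred Carrier ℓ) ℓ
  Unbounded X = ∀ α → ∃ λ β → X β × ¬ (β < α)

  IsRegular : Set (suc ℓ)
  IsRegular = (ℕ ↣ Carrier) × IsLeastCardinality Unbounded κ

  IsUncountable : Set ℓ
  IsUncountable = ℕ ≺ Carrier

IsSuccessorOf : Set ℓ → Cardinal ℓ → Set (suc ℓ)
IsSuccessorOf {ℓ} A ν = (A ≺ ∣ ν ∣) × (∀ (ξ : Cardinal ℓ) → A ≺ ∣ ξ ∣ → ∣ ν ∣ ↣ ∣ ξ ∣)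

record IsIdeal {S : Set ℓ} (K : Pred (Subset S) ℓ) : Set ℓ where
  field
    infinite   : ℕ ↣ S
    singletons : ∀ s A → IsSingleton s A → K A
    downward   : ∀ {A B} → A ⊆ B → K B → K A
    unions     : ∀ {A B} → K A → K B → K (A ∪ B)
    proper     : ∀ A → (∀ s → s ∈ A) → ¬ K A

_⁺ : {S : Set ℓ} → Pred (Subset S) ℓ → Pred (Subset S) ℓ
(K ⁺) A = ¬ K A

IsCof : {S : Set ℓ} → Pred (Subset S) ℓ → Cardinal ℓ → Set (suc ℓ)
IsCof {ℓ} {S} K = IsLeastCardinality Generates
  where
  Generates : Pred (Pred (Subset S) ℓ) ℓ
  Generates X = (∀ A → X A → K A) × (∀ B → K B ⇔ (∃ λ A → X A × B ⊆ A))

module _ (κ ƛ : Cardinal ℓ) where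

  P : Set ℓ
  P = Refinement (Subset ∣ ƛ ∣) λ a → Refinement ∣ ƛ ∣ (_∈ a) ≺ ∣ κ ∣

  infix 4 _⊑_

  _⊑_ : Rel P ℓ
  a ⊑ b = value a ⊆ value b

  I : Pred (Subset P) ℓ
  I A = ∃ λ a → ∀ b → a ⊑ b → ¬ (b ∈ A)

  record IsIdealOnP (H : Pred (Subset P) ℓ) : Set (suc ℓ) where
    field
      isIdeal  : IsIdeal H
      complete : ∀ (Y : Pred (Subset P) ℓ) U →
                 Refinement (Subset P) Y ≺ ∣ κ ∣ → (∀ A → Y A → H A) →
                 IsUnionOf Y U → H U
      fine     : ∀ A → I A → H A

  Dominating : Pred (Pred (∣ κ ∣ → P) ℓ) ℓ
  Dominating F = ∀ (g : ∣ κ ∣ → P) → ∃ λ f → F f × (∀ α → g α ⊑ f α)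

  Is𝔡 : Cardinal ℓ → Set (suc ℓ)
  Is𝔡 = IsLeastCardinality Dominating

  -- λ^{<κ}, as the set of all functions from some α < κ to λ.
  Power< : Set ℓ
  Power< = Σ ∣ κ ∣ λ α → Cardinal.Below κ α → ∣ ƛ ∣

  module _ (H : Pred (Subset P) ℓ) where

    record 𝓜 (Q : Pred (Subset P) ℓ) : Set ℓ where
      field
        positive       : ∀ A → Q A → (H ⁺) A
        large          : ∣ κ ∣ ↣ Refinement (Subset P) Q
        almostDisjoint : ∀ A B → Q A → Q B → A ≢ B → H (A ∩ B)
        maximal        : ∀ C → (H ⁺) C → ∃ λ A → Q A × (H ⁺) (A ∩ C)

    Is𝔞 : Cardinal ℓ → Set (suc ℓ)
    Is𝔞 μ =
      IsLeastCardinality 𝓜 μ ⊎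
      (¬ ∃ 𝓜 × (∃ λ ν → IsSuccessorOf Power< ν × (∣ μ ∣ ⤖ Subset ∣ ν ∣)))

    IsWeakπPoint : Set ℓ
    IsWeakπPoint =
      ∀ (f : ∣ κ ∣ → Subset P) → (∀ α → H (f α)) → ∀ A → (H ⁺) A →
      ∃ λ B → (H ⁺) B × B ⊆ A × (∀ α → I (B ∩ f α))

{-# OPTIONS --safe #-}
module Submission where

-- Let f : κ → P(P_κ(λ)) be such that A ∖ (X ∪ ⋃_{β<α} f(β)) is nonempty for all
-- X ∈ H and α < κ.  For X in a base of H of size cof(H), pick points g_X(α) of
-- these differences.  Since cof(H) < 𝔡, some h : κ → P_κ(λ) is dominated by no
-- g_X, and the set B of those b ∈ A such that b ∉ f(α) whenever b ⊇ h(β) for all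
-- β ≤ α then works for f: B ∩ f(α) ∈ I since ⋃_{β≤α} h(β) ∈ P_κ(λ) by regularity,
-- and B is not covered by X, because g_X(α) ∈ B as soon as h(α) ⊄ g_X(α).
-- With f : κ → H this is the weak π-point property.  With f an enumeration of a
-- maximal almost disjoint Q of size κ, it gives a positive B almost disjoint
-- from every member of Q, which is absurd.

open import Defs
open import Axiom.ExcludedMiddle using (ExcludedMiddle)
open import Axiom.Extensionality.Propositional
  using (Extensionality; implicit-extensionality)
open import Data.Bool using (true)
open import Data.Bool.Properties using (T?; T-∧; T-∨)
open import Data.Empty using (⊥-elim)
open import Data.Irrelevant using ([_])
open import Data.Maybe using (Maybe; just; nothing)
open import Data.Maybe.Properties using (just-injective)
open import Data.Nat.Properties using (0≢1+n)
open import Data.Product using (∃; _×_; _,_; proj₁; proj₂)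
open import Data.Refinement using (Refinement; value; _,_)
open import Data.Refinement.Properties using (value-injective)
open import Data.Sum using (_⊎_; inj₁; inj₂)
open import Function.Base using (_∘_)
open import Function.Bundles
  using (_↣_; _⤖_; _⇔_; mk↣; mk⇔; Injection; Bijection; Equivalence)
open import Function.Construct.Composition using (_↣-∘_)
open import Function.Construct.Symmetry using (⤖-sym)
open import Induction.WellFounded using (WellFounded; module All; module FixPoint)
open import Level using (Level; Lift; lift; lower)
open import Relation.Binary using (Rel; IsStrictTotalOrder; tri<; tri≈; tri>)
import Relation.Binary.Construct.On as On
open import Relation.Binary.PropositionalEquality
open import Relation.Nullary using (¬_; Dec; yes; no; contradiction)
open import Relation.Nullary.Decidable
  using (⌊_⌋; toWitness; fromWitness; recompute; decidable-stable)
open import Relation.Unary using (Pred)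

-- `R` need not be functional: `∃` carries its witness, so totality already supplies a choice of
-- values.
choose-↣ : ∀ {a b r} {A : Set a} {B : Set b} {R : A → B → Set r} →
           (∀ x → ∃ (R x)) →
           (∀ {x x′ y} → R x y → R x′ y → x ≡ x′) → A ↣ B
choose-↣ {R = R} total inj = mk↣ {to = λ x → proj₁ (total x)} λ {x} {x′} eq →
  inj (proj₂ (total x)) (subst (R x′) (sym eq) (proj₂ (total x′)))

⤖⇒↣ : ∀ {a b} {A : Set a} {B : Set b} → A ⤖ B → A ↣ B
⤖⇒↣ = Bijection.injection

module _ {ℓ : Level} (em : ExcludedMiddle ℓ) where

  ¬∀⇒∃¬ : {A : Set ℓ} {B : A → Set ℓ} → ¬ (∀ x → B x) → ∃ λ x → ¬ B x
  ¬∀⇒∃¬ ¬∀ = decidable-stable em λ ¬∃ →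
    ¬∀ λ x → decidable-stable em λ ¬Bx → ¬∃ (x , ¬Bx)

  witness : {A : Set ℓ} {B : A → Set ℓ} (u : Refinement A B) → B (value u)
  witness (_ , [ b ]) = recompute em b

  ⟦_⟧ : {A : Set ℓ} → Pred A ℓ → Subset A
  ⟦ φ ⟧ x = ⌊ em {φ x} ⌋

  ∈⟦_⟧⁺ : {A : Set ℓ} (φ : Pred A ℓ) {x : A} → φ x → x ∈ ⟦ φ ⟧
  ∈⟦ _ ⟧⁺ = fromWitness

  ∈⟦_⟧⁻ : {A : Set ℓ} (φ : Pred A ℓ) {x : A} → x ∈ ⟦ φ ⟧ → φ x
  ∈⟦ _ ⟧⁻ = toWitness

  image-↣ : {A B : Set ℓ} {D : Pred A ℓ} (f : A → B) →
            Refinement B (λ y → ∃ λ x → D x × y ≡ f x) ↣ Refinement A D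
  image-↣ f = choose-↣ {R = λ v u → value v ≡ f (value u)}
    (λ v → let (x , Dx , eq) = witness v in (x , [ Dx ]) , eq)
    (λ eq eq′ → value-injective (trans eq (sym eq′)))

  -- Comparability of sizes, by transfinite recursion.

  module _ (ext : Extensionality ℓ ℓ) (μ : Cardinal ℓ) {A : Set ℓ} (i : A ↣ ∣ μ ∣)
           (B : Set ℓ) where
    private
      open Cardinal μ
      open Injection i using (to; injective)
      module < = IsStrictTotalOrder isStrictTotalOrder

      _◁_ : Rel A ℓ
      x ◁ y = to x < to y

      ◁-wellFounded : WellFounded _◁_
      ◁-wellFounded = On.wellFounded to wellFounded

      Fresh : ∀ x → (∀ {y} → y ◁ x → Maybe B) → Pred B ℓ
      Fresh x F b = ∀ {y} (y◁x : y ◁ x) → F y◁x ≢ just b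

      -- The decision is an argument so that `pick-just` and `pick-nothing` can match on it. In the
      -- recursion, `nothing` records that all of `B` has been used.
      pick : (C : Pred B ℓ) → Dec (∃ C) → Maybe B
      pick C (yes (b , _)) = just b
      pick C (no _)        = nothing

      step : ∀ x → (∀ {y} → y ◁ x → Maybe B) → Maybe B
      step x F = pick (Fresh x F) em

      step-ext : ∀ x {F F′ : ∀ {y} → y ◁ x → Maybe B} →
                 (∀ {y} (y◁x : y ◁ x) → F y◁x ≡ F′ y◁x) → step x F ≡ step x F′
      step-ext x eq = cong (λ (F : ∀ {y} → y ◁ x → Maybe B) → step x F)
                        (implicit-extensionality ext (ext λ y◁x → eq y◁x))

      open FixPoint ◁-wellFounded (λ _ → Maybe B) step step-ext

      enum : A → Maybe B
      enum = All.wfRec ◁-wellFounded ℓ (λ _ → Maybe B) step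

      pick-just : ∀ {C : Pred B ℓ} {b} (d : Dec (∃ C)) → pick C d ≡ just b → C b
      pick-just (yes (_ , c)) refl = c

      pick-nothing : ∀ {C : Pred B ℓ} (d : Dec (∃ C)) → pick C d ≡ nothing → ¬ ∃ C
      pick-nothing (no ¬c) _ = ¬c

      enum-fresh : ∀ {x b} → enum x ≡ just b → ∀ {y} → y ◁ x → enum y ≢ just b
      enum-fresh {x} eq = pick-just em (trans (sym (unfold-wfRec {x})) eq)

      enum-injective : ∀ {x y b} → enum x ≡ just b → enum y ≡ just b → x ≡ y
      enum-injective {x} {y} eqx eqy with <.compare (to x) (to y)
      ... | tri< x◁y _ _ = contradiction eqx (enum-fresh eqy x◁y)
      ... | tri≈ _ eq _  = injective eq
      ... | tri> _ _ y◁x = contradiction eqy (enum-fresh eqx y◁x)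

      exhausted : ∀ {x} → enum x ≡ nothing → ∀ b → ∃ λ y → enum y ≡ just b
      exhausted {x} eq b = decidable-stable em λ ¬∃ →
        pick-nothing em (trans (sym (unfold-wfRec {x})) eq)
          (b , λ {y} _ eq′ → ¬∃ (y , eq′))

    -- A is enumerated by sending each x to an element of B not used before x.
    ↣-total : (A ↣ B) ⊎ (B ↣ A)
    ↣-total with em {∃ λ x → enum x ≡ nothing}
    ... | yes (x , eq) = inj₂ (choose-↣ {R = λ b y → enum y ≡ just b} (exhausted eq)
            λ eq₁ eq₂ → just-injective (trans (sym eq₁) eq₂))
    ... | no  ¬∃       = inj₁ (choose-↣ {R = λ x b → enum x ≡ just b} defined enum-injective)
      where
      defined : ∀ x → ∃ λ b → enum x ≡ just b
      defined x with enum x in eq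
      ... | just b  = b , refl
      ... | nothing = contradiction (x , eq) ¬∃

  -- Regular cardinals.

  module _ (κ : Cardinal ℓ) where
    open Cardinal κ
    private module < = IsStrictTotalOrder isStrictTotalOrder

    Below-↣ : ∀ α → Below α ↣ Carrier
    Below-↣ α = mk↣ {to = value} value-injective

    ≤-<-trans : ∀ {α β γ} → ¬ (α < β) → α < γ → β < γ
    ≤-<-trans {α} {β} α≮β α<γ with <.compare α β
    ... | tri< α<β _ _  = contradiction α<β α≮β
    ... | tri≈ _ refl _ = α<γ
    ... | tri> _ _ β<α  = <.trans β<α α<γ

    module _ (regular : IsRegular κ) where

      small⇒bounded : (X : Pred Carrier ℓ) → ¬ (Carrier ↣ Refinement Carrier X) →
                      ∃ λ α → ∀ β → X β → β < α
      small⇒bounded X small with ¬∀⇒∃¬ (small ∘ proj₂ (proj₂ regular) X)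
      ... | α , none = α , λ β Xβ → decidable-stable em λ β≮α → none (β , Xβ , β≮α)

      <-unbounded : ∀ α → ∃ λ β → α < β
      <-unbounded α = let (β , bound) = small⇒bounded (_≡ α) small in β , bound α refl
        where
        small : ¬ (Carrier ↣ Refinement Carrier (_≡ α))
        -- Since κ is infinite, an injection of κ into a singleton would identify 0 and 1.
        small i = 0≢1+n (Injection.injective j (value-injective (trans (j≡α 0) (sym (j≡α 1)))))
          where
          j   = i ↣-∘ proj₁ regular
          j≡α = λ m → witness (Injection.to j m)

      -- If every fibre were small, regularity would bound the fibre over β by some `s β`. As γ lies
      -- below `s (r γ)`, the values of `s` on β < α would be unbounded, hence κ many, although they
      -- form an image of the initial segment α.
      below-cover⇒fibre-large : ∀ {α} (r : Carrier → Carrier) → (∀ γ → r γ < α) →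
        ∃ λ β → Carrier ↣ Refinement Carrier (λ γ → r γ ≡ β)
      below-cover⇒fibre-large {α} r r< = decidable-stable em λ ¬∃ →
        let bound : ∀ β → ∃ λ δ → ∀ γ → r γ ≡ β → γ < δ
            bound β = small⇒bounded (λ γ → r γ ≡ β) λ i → ¬∃ (β , i)
            s       = λ β → proj₁ (bound β)
            γ<s∘r   = λ γ → proj₂ (bound (r γ)) γ refl
        in initial α (image-↣ s ↣-∘ proj₂ (proj₂ regular) (λ δ → ∃ λ β → β < α × δ ≡ s β)
             λ γ → s (r γ) , (r γ , r< γ , refl) , <.asym (γ<s∘r γ))

  -- Bounds in P_κ(λ) and undominated functions.

  module _ (ext : Extensionality ℓ ℓ) (κ ƛ : Cardinal ℓ) (regular : IsRegular κ) where
    open Cardinal κ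
    private module < = IsStrictTotalOrder isStrictTotalOrder

    -- The bound is the union `U` of the `h β`. Given an injection of κ into `U`, sending each γ to
    -- some β < α whose `h β` contains the image of γ has a fibre of size κ, so κ would inject into
    -- a single `h β`.
    ⊑-bound : (h : Carrier → P κ ƛ) → ∀ α → ∃ λ a → ∀ β → β < α → _⊑_ κ ƛ (h β) a
    ⊑-bound h α = (U , [ U≺κ ]) , λ β β<α x x∈h → ∈⟦ Covered ⟧⁺ (β , β<α , lift x∈h)
      where
      Covered : Pred ∣ ƛ ∣ ℓ
      Covered x = ∃ λ β → β < α × Lift ℓ (x ∈ value (h β))

      U : Subset ∣ ƛ ∣
      U = ⟦ Covered ⟧

      κ↣̸U : ¬ (Carrier ↣ Refinement ∣ ƛ ∣ (_∈ U))
      κ↣̸U e = let (β , i) = below-cover⇒fibre-large κ regular (λ γ → proj₁ (index γ))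
                                  (λ γ → proj₁ (proj₂ (index γ)))
              in proj₂ (witness (h β)) (fibre-↣ β ↣-∘ i)
        where
        index : ∀ γ → Covered (value (Injection.to e γ))
        index γ with Injection.to e γ
        ... | x , [ x∈U ] = ∈⟦ Covered ⟧⁻ (recompute (T? (U x)) x∈U)

        fibre-↣ : ∀ β → Refinement Carrier (λ γ → proj₁ (index γ) ≡ β) ↣
                        Refinement ∣ ƛ ∣ (_∈ value (h β))
        fibre-↣ β = choose-↣ {R = λ u v → value (Injection.to e (value u)) ≡ value v}
          (λ u → let (β′ , _ , lift x∈h) = index (value u)
                 in (_ , [ subst (λ β → _ ∈ value (h β)) (witness u) x∈h ]) , refl)
          (λ eq eq′ → value-injective
            (Injection.injective e (value-injective (trans eq (sym eq′)))))

      U≺κ : Refinement ∣ ƛ ∣ (_∈ U) ≺ Carrier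
      -- `≺` also asks for an injection of `U` into κ; comparability gives it, with the well-order
      -- of `U` inherited from λ.
      U≺κ with ↣-total ext ƛ (mk↣ {to = value} value-injective) Carrier
      ... | inj₁ i = i , κ↣̸U
      ... | inj₂ i = contradiction i κ↣̸U

    -- The functions `g u` form a family that injects into `U`, so the family is too small to be
    -- dominating.
    undominated : (𝔡 : Cardinal ℓ) → Is𝔡 κ ƛ 𝔡 → {U : Set ℓ} → ¬ (∣ 𝔡 ∣ ↣ U) →
      (g : U → Carrier → P κ ƛ) → ∃ λ h → ∀ u → ∃ λ α → ¬ (_⊑_ κ ƛ (h α) (g u α))
    undominated 𝔡 is𝔡 {U} small g =
      let (h , ¬dom) = ¬∀⇒∃¬ {B = λ h → ∃ λ f → F f × (∀ α → _⊑_ κ ƛ (h α) (f α))}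
                         λ dom → small (F↣U ↣-∘ proj₂ is𝔡 F dom)
      in h , λ u → ¬∀⇒∃¬ λ h⊑g → ¬dom (g u , (u , refl) , h⊑g)
      where
      F : Pred (Carrier → P κ ƛ) ℓ
      F f = ∃ λ u → f ≡ g u

      F↣U : Refinement _ F ↣ U
      F↣U = choose-↣ {R = λ v u → value v ≡ g u} witness
              (λ eq eq′ → value-injective (trans eq (sym eq′)))

    -- Diagonalisation against a base of the ideal.

    module _ (H : Pred (Subset (P κ ƛ)) ℓ) (H-ideal : IsIdealOnP κ ƛ H) where
      open IsIdealOnP H-ideal
      open IsIdeal isIdeal

      -- Otherwise `X` and the fewer than κ sets `f β ∩ A` would cover `A`, against κ-completeness.
      -- Only the traces on `A` are assumed to lie in `H`, so that the `f β` may be positive, as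
      -- members of an almost disjoint family are.
      positive∖small-union : ∀ {A X} → (H ⁺) A → H X → (f : Carrier → Subset (P κ ƛ)) →
        ∀ α → (∀ β → β < α → H (f β ∩ A)) →
        ∃ λ b → b ∈ A × ¬ (b ∈ X) × (∀ β → β < α → ¬ (b ∈ f β))
      positive∖small-union {A} {X} A⁺ HX f α Hf = decidable-stable em λ ¬∃ →
        A⁺ (downward (cover ¬∃) (unions HX HU))
        where
        Y : Pred (Subset (P κ ƛ)) ℓ
        Y S = ∃ λ β → β < α × S ≡ f β ∩ A

        Covered : Pred (P κ ƛ) ℓ
        Covered b = ∃ λ S → Y S × b ∈ S

        U : Subset (P κ ƛ)
        U = ⟦ Covered ⟧

        HU : H U
        HU = complete Y U
          (Below-↣ κ α ↣-∘ image-↣ (λ β → f β ∩ A) ,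
           λ i → initial α (image-↣ (λ β → f β ∩ A) ↣-∘ i))
          (λ { S (β , β<α , refl) → Hf β β<α })
          (λ b → mk⇔ ∈⟦ Covered ⟧⁻ ∈⟦ Covered ⟧⁺)

        cover : ¬ (∃ λ b → b ∈ A × ¬ (b ∈ X) × (∀ β → β < α → ¬ (b ∈ f β))) → A ⊆ X ∪ U
        cover ¬∃ b b∈A = Equivalence.from T-∨ (cover′ (T? (X b)))
          where
          cover′ : Dec (b ∈ X) → b ∈ X ⊎ b ∈ U
          cover′ (yes b∈X) = inj₁ b∈X
          cover′ (no  b∉X) = inj₂ (decidable-stable (T? (U b)) λ b∉U →
            ¬∃ (b , b∈A , b∉X , λ β β<α b∈f → b∉U (∈⟦ Covered ⟧⁺
              (_ , (β , β<α , refl) , Equivalence.from T-∧ (b∈f , b∈A)))))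

      module _ (cofH 𝔡 : Cardinal ℓ) (isCof : IsCof H cofH) (is𝔡 : Is𝔡 κ ƛ 𝔡)
               (cof<𝔡 : cofH <ᶜ 𝔡) where

        diagonal : ∀ A (f : Carrier → Subset (P κ ƛ)) →
          (∀ α X → H X → ∃ λ b → b ∈ A × ¬ (b ∈ X) × (∀ β → β < α → ¬ (b ∈ f β))) →
          ∃ λ B → (H ⁺) B × B ⊆ A × (∀ α → I κ ƛ (B ∩ f α))
        diagonal A f avoid = B , B⁺ , (λ b b∈B → lower (proj₁ (∈⟦ Diagonal ⟧⁻ b∈B))) , B∩f-bounded
          where
          base : Pred (Subset (P κ ƛ)) ℓ
          base = proj₁ (proj₁ isCof)

          base⊆H : ∀ X → base X → H X
          base⊆H = proj₁ (proj₁ (proj₂ (proj₁ isCof)))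

          generates : ∀ B → H B → ∃ λ X → base X × B ⊆ X
          generates B = Equivalence.to (proj₂ (proj₁ (proj₂ (proj₁ isCof))) B)

          avoid-base : ∀ (u : Refinement _ base) α →
            ∃ λ b → b ∈ A × ¬ (b ∈ value u) × (∀ β → β < α → ¬ (b ∈ f β))
          avoid-base u α = avoid α (value u) (base⊆H _ (witness u))

          g : Refinement _ base → Carrier → P κ ƛ
          g u α = proj₁ (avoid-base u α)

          escape : ∃ λ h → ∀ u → ∃ λ α → ¬ (_⊑_ κ ƛ (h α) (g u α))
          escape = undominated 𝔡 is𝔡
            (λ i → proj₂ cof<𝔡 (⤖⇒↣ (proj₂ (proj₂ (proj₁ isCof))) ↣-∘ i)) g

          h : Carrier → P κ ƛ
          h = proj₁ escape

          Diagonal : Pred (P κ ƛ) ℓ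
          Diagonal b = Lift ℓ (b ∈ A) ×
            (∀ α → (∀ β → ¬ (α < β) → _⊑_ κ ƛ (h β) b) → ¬ (b ∈ f α))

          B : Subset (P κ ƛ)
          B = ⟦ Diagonal ⟧

          B⁺ : (H ⁺) B
          B⁺ HB =
            let (X , bX , B⊆X) = generates B HB
                u              = X , [ bX ]
                (α , h⋢g)      = proj₂ escape u
                (b∈A , b∉X , b∉f) = proj₂ (avoid-base u α)
            -- For γ < α the chosen point avoids `f γ`. For γ ≥ α the premise of `Diagonal` at γ
            -- would include `h α ⊑ g u α`, which fails by the choice of α.
            in b∉X (B⊆X (g u α) (∈⟦ Diagonal ⟧⁺ (lift b∈A , λ γ h⊑b b∈fγ →
                 h⋢g (h⊑b α λ γ<α → b∉f γ γ<α b∈fγ))))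

          B∩f-bounded : ∀ α → I κ ƛ (B ∩ f α)
          B∩f-bounded α =
            -- `⊑-bound` covers strictly smaller indices only, while `Diagonal` needs all β ≤ α;
            -- hence a larger α′.
            let (α′ , α<α′) = <-unbounded κ regular α
                (a , h⊑a)   = ⊑-bound h α′
            in a , λ b a⊑b b∈B∩f →
              let (b∈B , b∈f) = Equivalence.to T-∧ b∈B∩f
              in proj₂ (∈⟦ Diagonal ⟧⁻ b∈B) α
                   (λ β α≮β x x∈h → a⊑b x (h⊑a β (≤-<-trans κ α≮β α<α′) x x∈h)) b∈f

        -- The weak π-point property and the bound on 𝔞.

        weakπPoint : IsWeakπPoint κ ƛ H
        weakπPoint f Hf A A⁺ = diagonal A f λ α X HX →
          positive∖small-union A⁺ HX f α λ β _ →
            downward (λ b → proj₁ ∘ Equivalence.to T-∧) (Hf β)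

        𝓜⇒↣̸κ : ∀ {Q} → 𝓜 κ ƛ H Q → ¬ (Refinement _ Q ↣ Carrier)
        𝓜⇒↣̸κ {Q} Q∈𝓜 j = refute (diagonal (λ _ → true) f avoid)
          where
          open 𝓜 Q∈𝓜
          open Injection j using () renaming (to to code; injective to code-injective)

          Coded : Carrier → Pred (P κ ƛ) ℓ
          Coded α b = ∃ λ (u : Refinement _ Q) → code u ≡ α × Lift ℓ (b ∈ value u)

          -- `f α` is the member of `Q` with code α, and the empty set when α is not a code.
          f : Carrier → Subset (P κ ƛ)
          f α = ⟦ Coded α ⟧

          -- Were all codes below α, then κ would inject through `Q` into an initial segment of
          -- itself. The member found is almost disjoint from every `f β` with β < α, so it serves
          -- as the positive set in `avoid`.
          late : ∀ α → ∃ λ u → ¬ (code u < α)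
          late α = ¬∀⇒∃¬ λ early → initial α
            (choose-↣ {R = λ u v → code u ≡ value v} (λ u → (code u , [ early u ]) , refl)
               (λ eq eq′ → code-injective (trans eq (sym eq′)))
             ↣-∘ large)

          f∩-small : ∀ {X} → H X → ∀ u β → code u ≢ β → H (f β ∩ value u)
          f∩-small HX u β u≢β with em {∃ λ v → code v ≡ β}
          ... | yes (v , refl) = downward f∩u⊆v∩u
                  (almostDisjoint _ _ (witness v) (witness u)
                     λ eq → u≢β (cong code (value-injective (sym eq))))
            where
            f∩u⊆v∩u : f (code v) ∩ value u ⊆ value v ∩ value u
            f∩u⊆v∩u b b∈ with Equivalence.to T-∧ b∈
            ... | b∈f , b∈u with ∈⟦ Coded (code v) ⟧⁻ b∈f
            ... | w , eq , lift b∈w = Equivalence.from T-∧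
                    (subst (λ v → b ∈ value v) (code-injective eq) b∈w , b∈u)
          -- Here `f β` is empty; `X` serves as a member of `H` above the empty set.
          ... | no ¬∃ = downward (λ b b∈ → ⊥-elim (¬∃ (coded b b∈))) HX
            where
            coded : ∀ b → b ∈ f β ∩ value u → ∃ λ v → code v ≡ β
            coded b b∈ with ∈⟦ Coded β ⟧⁻ (proj₁ (Equivalence.to T-∧ b∈))
            ... | v , eq , _ = v , eq

          avoid : ∀ α X → H X →
            ∃ λ b → b ∈ (λ _ → true) × ¬ (b ∈ X) × (∀ β → β < α → ¬ (b ∈ f β))
          avoid α X HX with late α
          ... | u , u≮α with positive∖small-union (positive _ (witness u)) HX f α
                               (λ β β<α → f∩-small HX u β
                                  λ eq → u≮α (subst (_< α) (sym eq) β<α))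
          ... | b , _ , b∉ = b , _ , b∉

          refute : ¬ (∃ λ B → (H ⁺) B × B ⊆ (λ _ → true) × (∀ α → I κ ƛ (B ∩ f α)))
          refute (B , B⁺ , _ , B∩f) with maximal B B⁺
          ... | A , QA , A∩B⁺ = A∩B⁺ (downward A∩B⊆B∩f (fine _ (B∩f (code u))))
            where
            u : Refinement _ Q
            u = A , [ QA ]

            A∩B⊆B∩f : A ∩ B ⊆ B ∩ f (code u)
            A∩B⊆B∩f b b∈ with Equivalence.to T-∧ b∈
            ... | b∈A , b∈B =
                  Equivalence.from T-∧ (b∈B , ∈⟦ Coded (code u) ⟧⁺ (u , refl , lift b∈A))

        κ<𝔞 : κ <ᶜ ƛ → ∀ 𝔞 → Is𝔞 κ ƛ H 𝔞 → κ <ᶜ 𝔞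
        κ<𝔞 _ 𝔞 (inj₁ ((Q , Q∈𝓜 , Q⤖𝔞) , _)) =
          ⤖⇒↣ Q⤖𝔞 ↣-∘ 𝓜.large Q∈𝓜 , λ i → 𝓜⇒↣̸κ Q∈𝓜 (i ↣-∘ ⤖⇒↣ Q⤖𝔞)
        -- Without a member of `𝓜`, the chain is κ ≤ λ ≤ λ^{<κ} < ν ≤ 2^ν = 𝔞.
        κ<𝔞 (κ↣ƛ , _) 𝔞 (inj₂ (_ , ν , ((Power<↣ν , ν↣̸Power<) , _) , 𝔞⤖2^ν)) =
          ν↣𝔞 ↣-∘ (Power<↣ν ↣-∘ κ↣Power<) , λ i → ν↣̸Power< (κ↣Power< ↣-∘ (i ↣-∘ ν↣𝔞))
          where
          ν↣2^ν : ∣ ν ∣ ↣ Subset ∣ ν ∣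
          ν↣2^ν = choose-↣ {R = λ x X → ∀ y → y ∈ X ⇔ y ≡ x}
            (λ x → ⟦ _≡ x ⟧ , λ y → mk⇔ ∈⟦ _≡ x ⟧⁻ ∈⟦ _≡ x ⟧⁺)
            (λ {x} x-only x′-only → Equivalence.to (x′-only x) (Equivalence.from (x-only x) refl))

          ν↣𝔞 : ∣ ν ∣ ↣ ∣ 𝔞 ∣
          ν↣𝔞 = ⤖⇒↣ (⤖-sym 𝔞⤖2^ν) ↣-∘ ν↣2^ν

          ƛ↣Power< : ∣ ƛ ∣ ↣ Power< κ ƛ
          ƛ↣Power< =
            -- Elements of λ become constant functions. Their domain α must be nonempty for the
            -- value to be recovered, so α is taken above some `o`.
            let o         = Injection.to (proj₁ regular) 0
                (α , o<α) = <-unbounded κ regular o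
            in choose-↣ {R = λ x p → Below (proj₁ p) × (∀ β → proj₂ p β ≡ x)}
                 (λ x → (α , λ _ → x) , (o , [ o<α ]) , λ _ → refl)
                 (λ { (β , f≡x) (_ , f≡x′) → trans (sym (f≡x β)) (f≡x′ β) })

          κ↣Power< : Carrier ↣ Power< κ ƛ
          κ↣Power< = ƛ↣Power< ↣-∘ κ↣ƛ

theorem8p4 : ∀ {ℓ : Level} → ExcludedMiddle ℓ → Extensionality ℓ ℓ →
    (κ ƛ : Cardinal ℓ) → IsRegular κ → IsUncountable κ → κ <ᶜ ƛ →
    (H : Pred (Subset (P κ ƛ)) ℓ) → IsIdealOnP κ ƛ H →
    (cofH 𝔡 : Cardinal ℓ) → IsCof H cofH → Is𝔡 κ ƛ 𝔡 → cofH <ᶜ 𝔡 →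
    (∀ (𝔞 : Cardinal ℓ) → Is𝔞 κ ƛ H 𝔞 → κ <ᶜ 𝔞) × IsWeakπPoint κ ƛ H
theorem8p4 em ext κ ƛ regular _ κ<ƛ H H-ideal cofH 𝔡 isCof is𝔡 cof<𝔡 =
  κ<𝔞 em ext κ ƛ regular H H-ideal cofH 𝔡 isCof is𝔡 cof<𝔡 κ<ƛ ,
  weakπPoint em ext κ ƛ regular H H-ideal cofH 𝔡 isCof is𝔡 cof<𝔡
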